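{- There is an absolute constant $C>0$ such that the following holds. Let $q$ be an odd prime power such that $2$ is a square in $\mathbb F_q$. If $E\subseteq\mathbb F_q$ and $|E|\ge Cq^{2/3}$, then $|\Box(E)|\ge q/2$.
   Context: $\mathbb F_q$ is the field with $q$ elements, $q$ odd. For $E\subseteq\mathbb F_q$, $\Box(E)=\{(x-y)^2+(x-z)^2: x,y,z\in E,\ y\ne z\}$. -}

module Defs where

open import Data.Nat using (ℕ)
open import Data.Fin using (Fin; _≟_)
open import Data.Fin.Properties using (any?)
open import Data.Fin.Subset using (Subset; _∈_)
open import Data.Fin.Subset.Properties using (_∈?_)
open import Data.Vec using (tabulate)
open import Data.Product using (Σ; ∃; _×_)
open import Data.Product.Properties using () 
open import Relation.Nullary using (¬_)
open import Relation.Nullary.Decidable using (⌊_⌋; _×-dec_; ¬?)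
open import Relation.Binary.PropositionalEquality using (_≡_)
open import Algebra.Core using (Op₁; Op₂)
open import Algebra.Structures using (IsCommutativeRing)

-- A finite field with q elements, with carrier Fin q (every finite field of
-- order q is isomorphic to one of this form) and propositional equality.
record FiniteField (q : ℕ) : Set where
  field
    _+_ _*_ : Op₂ (Fin q)
    -_      : Op₁ (Fin q)
    0# 1#   : Fin q
    isCommutativeRing : IsCommutativeRing _≡_ _+_ _*_ -_ 0# 1#
    0≢1     : ¬ (0# ≡ 1#)
    inverse : ∀ x → ¬ (x ≡ 0#) → ∃ λ y → (x * y) ≡ 1#

  _-_ : Op₂ (Fin q)
  x - y = x + (- y)

  sq : Op₁ (Fin q)
  sq x = x * x

  2# : Fin q
  2# = 1# + 1#

  TwoIsSquare : Set
  TwoIsSquare = ∃ λ t → sq t ≡ 2#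

  InBox : Subset q → Fin q → Set
  InBox E w = ∃ λ x → ∃ λ y → ∃ λ z →
    (x ∈ E) × (y ∈ E) × (z ∈ E) × (¬ (y ≡ z)) × (w ≡ (sq (x - y) + sq (x - z)))

  Box : Subset q → Subset q
  Box E = tabulate λ w → ⌊ any? (λ x → any? (λ y → any? (λ z →
    (x ∈? E) ×-dec ((y ∈? E) ×-dec ((z ∈? E) ×-dec (¬? (y ≟ z) ×-dec
      (w ≟ (sq (x - y) + sq (x - z))))))))) ⌋

{-# OPTIONS --safe #-}
module Submission where

-- Expanding, (x − y)² + (x − z)² = 2x² − 2x(y + z) + (y² + z²), so up to the term
-- 2x² each unordered pair {y , z} gives a line in the (x , w)-plane, and distinct
-- unordered pairs give distinct lines because 2 ≠ 0.  Two distinct lines share at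
-- most one x, so with M = |E|² − |E| ordered pairs the number hits(x , w) of pairs
-- through (x , w) satisfies ∑ hits² ≤ M² + 2qM, while ∑ hits = qM.  Hence
-- ∑ (q·hits − M)² ≤ 2q³M.  Every point with x ∈ E and w ∉ □(E) is missed and
-- contributes M², so |E| (q − |□(E)|) M ≤ 2q³, which is impossible when
-- |□(E)| < q/2 and |E|³ ≥ 8q².

open import Defs
open import Data.Nat using (ℕ; _*_; _^_; _≤_; _<_)
open import Data.Nat.Divisibility using (_∣_)
open import Data.Fin.Subset using (Subset; ∣_∣)
open import Data.Product using (Σ; _×_)
open import Relation.Nullary using (¬_)

open import Algebra.Bundles using (CommutativeSemiring)
open import Algebra.Structures using (IsCommutativeRing)
import Algebra.Solver.Ring.NaturalCoefficients.Default as SemiringSolver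
open import Data.Bool using (true; false)
open import Data.Nat using (zero; suc; _+_; _∸_; z≤n; s≤s; >-nonZero; nonZero)
open import Data.Nat.Divisibility using (divides)
open import Data.Nat.Properties
open import Data.Nat.Solver using (module +-*-Solver)
open import Algebra.Properties.Semiring.Sum +-*-semiring
open import Data.Fin using (Fin; zero; suc; remQuot; combine; _↑ˡ_; _↑ʳ_)
import Data.Fin as Fin
import Data.Fin.Properties as Finₚ
open import Data.Fin.Permutation using (permutation)
open import Data.Fin.Subset using (_∈_; ∁)
open import Data.Fin.Subset.Properties using (_∈?_; x∈∁p⇒x∉p; ∣∁p∣≡n∸∣p∣; ∣p∣≤n; drop-there)
open import Data.Vec using ([]; _∷_; there)
open import Data.Vec.Properties using (lookup∘tabulate; lookup⇒[]=)
open import Data.Product using (_,_; uncurry)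
open import Data.Sum using (_⊎_; inj₁; inj₂)
import Data.Product as Product
import Data.Sum as Sum
open import Data.Empty using (⊥-elim)
open import Function using (_∘_)
open import Relation.Nullary using (Dec; yes; no)
open import Relation.Nullary.Decidable using (¬?; ⌊_⌋)
open import Relation.Binary.Definitions using (tri<; tri≈; tri>)
open import Relation.Binary.PropositionalEquality

open +-*-Solver using (_:+_; _:*_; _:=_; con) renaming (solve to solveℕ)

-- Indicators and finite sums

𝟙 : ∀ {a} {A : Set a} → Dec A → ℕ
𝟙 (yes _) = 1
𝟙 (no _)  = 0

𝟙≤1 : ∀ {a} {A : Set a} (d : Dec A) → 𝟙 d ≤ 1
𝟙≤1 (yes _) = ≤-refl
𝟙≤1 (no _)  = z≤n

𝟙-cong : ∀ {a b} {A : Set a} {B : Set b} (d : Dec A) (d′ : Dec B) →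
         (A → B) → (B → A) → 𝟙 d ≡ 𝟙 d′
𝟙-cong (yes _) (yes _)  _ _ = refl
𝟙-cong (no _)  (no _)   _ _ = refl
𝟙-cong (yes a) (no ¬b)  f _ = ⊥-elim (¬b (f a))
𝟙-cong (no ¬a) (yes b)  _ g = ⊥-elim (¬a (g b))

𝟙-true : ∀ {a} {A : Set a} (d : Dec A) → A → 𝟙 d ≡ 1
𝟙-true (yes _) _ = refl
𝟙-true (no ¬a) a = ⊥-elim (¬a a)

𝟙-false : ∀ {a} {A : Set a} (d : Dec A) → ¬ A → 𝟙 d ≡ 0
𝟙-false (yes a) ¬a = ⊥-elim (¬a a)
𝟙-false (no _)  _  = refl

⌊⌋-true : ∀ {a} {A : Set a} (d : Dec A) → A → ⌊ d ⌋ ≡ true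
⌊⌋-true (yes _) _ = refl
⌊⌋-true (no ¬a) a = ⊥-elim (¬a a)

∑-mono-≤ : ∀ {n} {f g : Fin n → ℕ} → (∀ i → f i ≤ g i) → sum f ≤ sum g
∑-mono-≤ {zero}  f≤g = z≤n
∑-mono-≤ {suc n} f≤g = +-mono-≤ (f≤g zero) (∑-mono-≤ (f≤g ∘ suc))

∑-const : ∀ n c → ∑[ i < n ] c ≡ n * c
∑-const zero    c = refl
∑-const (suc n) c = cong (c +_) (∑-const n c)

∑-zero : ∀ {n} {f : Fin n → ℕ} → (∀ i → f i ≡ 0) → sum f ≡ 0
∑-zero {n} f≡0 = trans (sum-cong-≗ f≡0) (sum-replicate-zero n)

∑-δ : ∀ {n} (f : Fin n → ℕ) j → ∑[ i < n ] (𝟙 (i Fin.≟ j) * f i) ≡ f j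
∑-δ {suc n} f zero =
  trans (cong₂ _+_ (+-identityʳ (f zero)) (sum-replicate-zero n)) (+-identityʳ (f zero))
∑-δ f (suc j) = trans
  (sum-cong-≗ λ i → cong (_* f (suc i))
    (𝟙-cong (suc i Fin.≟ suc j) (i Fin.≟ j) Finₚ.suc-injective (cong suc)))
  (∑-δ (f ∘ suc) j)

∑-δ₁ : ∀ {n} (j : Fin n) → ∑[ i < n ] 𝟙 (i Fin.≟ j) ≡ 1
∑-δ₁ j = trans (sum-cong-≗ λ i → sym (*-identityʳ (𝟙 (i Fin.≟ j)))) (∑-δ (λ _ → 1) j)

∑-𝟙-atMostOne : ∀ {n} {P : Fin n → Set} (P? : ∀ i → Dec (P i)) →
                (∀ {i j} → P i → P j → i ≡ j) → ∑[ i < n ] 𝟙 (P? i) ≤ 1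
∑-𝟙-atMostOne {zero}  P? unique = z≤n
∑-𝟙-atMostOne {suc n} P? unique with P? zero
... | yes p₀ = ≤-reflexive (cong suc
  (∑-zero λ i → 𝟙-false (P? (suc i)) λ pᵢ → Finₚ.0≢1+n (unique p₀ pᵢ)))
... | no _   = ∑-𝟙-atMostOne (P? ∘ suc) λ p p′ → Finₚ.suc-injective (unique p p′)

∑-𝟙-≤n : ∀ {n} {P : Fin n → Set} (P? : ∀ i → Dec (P i)) → ∑[ i < n ] 𝟙 (P? i) ≤ n
∑-𝟙-≤n {n} P? = ≤-trans (∑-mono-≤ (𝟙≤1 ∘ P?)) (≤-reflexive (trans (∑-const n 1) (*-identityʳ n)))

∑-split : ∀ m {n} (h : Fin (m + n) → ℕ) →
          sum h ≡ ∑[ i < m ] h (i ↑ˡ n) + ∑[ j < n ] h (m ↑ʳ j)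
∑-split zero    h = refl
∑-split (suc m) h =
  trans (cong (h zero +_) (∑-split m (h ∘ suc))) (sym (+-assoc (h zero) _ _))

∑-combine : ∀ m {n} (h : Fin (m * n) → ℕ) →
            sum h ≡ ∑[ i < m ] ∑[ j < n ] h (combine i j)
∑-combine zero        h = refl
∑-combine (suc m) {n} h =
  trans (∑-split n h) (cong (∑[ j < n ] h (j ↑ˡ _) +_) (∑-combine m (h ∘ (n ↑ʳ_))))

-- This lets an ordered pair (y , z) serve as a single index in `Fin (q * q)`, so that the incidence
-- argument runs over one family of curves.
∑-remQuot : ∀ {m n} (g : Fin m → Fin n → ℕ) →
            ∑[ k < m * n ] uncurry g (remQuot n k) ≡ ∑[ i < m ] ∑[ j < n ] g i j
∑-remQuot {m} {n} g = trans (∑-combine m (uncurry g ∘ remQuot n))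
  (sum-cong-≗ λ i → sum-cong-≗ λ j → cong (uncurry g) (Finₚ.remQuot-combine i j))

∑-product : ∀ {m n} (f : Fin m → ℕ) (g : Fin n → ℕ) →
            ∑[ i < m ] ∑[ j < n ] (f i * g j) ≡ sum f * sum g
∑-product f g = trans (sum-cong-≗ λ i → sym (*-distribˡ-sum (f i) g)) (sym (*-distribʳ-sum (sum g) f))

∣p∣≡∑𝟙 : ∀ {n} (p : Subset n) → ∣ p ∣ ≡ ∑[ i < n ] 𝟙 (i ∈? p)
∣p∣≡∑𝟙 []          = refl
∣p∣≡∑𝟙 (b ∷ p) with ∣p∣≡∑𝟙 p | sum-cong-≗ (λ i → 𝟙-cong (i ∈? p) (suc i ∈? (b ∷ p)) there drop-there)
∣p∣≡∑𝟙 (true ∷ p)  | ih | eq = cong suc (trans ih eq)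
∣p∣≡∑𝟙 (false ∷ p) | ih | eq = trans ih eq

-- Each orbit {i , σ i} has exactly one member lying below its image. Reindexing by σ exchanges `up`
-- and `down`, so both have the same total. Applied to translation by 1, this rules out
-- characteristic 2.
fixedPointFreeInvolution⇒even : ∀ {n} (σ : Fin n → Fin n) →
  (∀ i → σ (σ i) ≡ i) → (∀ i → σ i ≢ i) → 2 ∣ n
fixedPointFreeInvolution⇒even {n} σ σσ≡id σ≢id = divides half (begin
  n                                                ≡⟨ *-identityʳ n ⟨
  n * 1                                            ≡⟨ ∑-const n 1 ⟨
  ∑[ i < n ] 1                                     ≡⟨ sum-cong-≗ trichotomy ⟩
  ∑[ i < n ] (up i + down i)                       ≡⟨ ∑-distrib-+ up down ⟩
  half + sum down                                  ≡⟨ cong (half +_) (∑-permute down (permutation σ σ σσ≡id σσ≡id)) ⟩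
  half + ∑[ i < n ] down (σ i)                     ≡⟨ cong (half +_) (sum-cong-≗ down∘σ) ⟩
  half + half                                      ≡⟨ cong (half +_) (sym (+-identityʳ half)) ⟩
  2 * half                                         ≡⟨ *-comm 2 half ⟩
  half * 2                                         ∎)
  where
  open ≡-Reasoning
  up down : Fin n → ℕ
  up i   = 𝟙 (i Fin.<? σ i)
  down i = 𝟙 (σ i Fin.<? i)
  half : ℕ
  half = sum up
  down∘σ : ∀ i → down (σ i) ≡ up i
  down∘σ i = cong (λ j → 𝟙 (j Fin.<? σ i)) (σσ≡id i)
  trichotomy : ∀ i → 1 ≡ up i + down i
  trichotomy i with Finₚ.<-cmp i (σ i)
  ... | tri< lt _ ¬gt = sym (cong₂ _+_ (𝟙-true (i Fin.<? σ i) lt) (𝟙-false (σ i Fin.<? i) ¬gt))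
  ... | tri≈ _ eq _   = ⊥-elim (σ≢id i (sym eq))
  ... | tri> ¬lt _ gt = sym (cong₂ _+_ (𝟙-false (i Fin.<? σ i) ¬lt) (𝟙-true (σ i Fin.<? i) gt))

-- The second moment of incidences

-- The two sides differ by the square of the difference d. Ordering a and b first keeps d a natural
-- number.
2ab≤a²+b² : ∀ a b → 2 * (a * b) ≤ a * a + b * b
2ab≤a²+b² a b with ≤-total a b
... | inj₁ a≤b = lemma a (b ∸ a) (m+[n∸m]≡n a≤b)
  where
  lemma : ∀ a d {b} → a + d ≡ b → 2 * (a * b) ≤ a * a + b * b
  lemma a d refl = ≤-trans (m≤m+n _ (d * d)) (≤-reflexive (solveℕ 2 (λ a d →
    con 2 :* (a :* (a :+ d)) :+ d :* d := a :* a :+ (a :+ d) :* (a :+ d)) refl a d))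
... | inj₂ b≤a = lemma b (a ∸ b) (m+[n∸m]≡n b≤a)
  where
  lemma : ∀ b d {a} → b + d ≡ a → 2 * (a * b) ≤ a * a + b * b
  lemma b d refl = ≤-trans (m≤m+n _ (d * d)) (≤-reflexive (solveℕ 2 (λ b d →
    con 2 :* ((b :+ d) :* b) :+ d :* d := (b :+ d) :* (b :+ d) :+ b :* b) refl b d))

-- An index p stands for the curve w = `f x p` over the x-axis, counted with weight `e p`. Then
-- `hits x w` is the total weight of the curves through the point (x , w).
module Incidence {q n : ℕ} (e : Fin n → ℕ) (f : Fin q → Fin n → Fin q) where

  M : ℕ
  M = sum e

  hits : Fin q → Fin q → ℕ
  hits x w = ∑[ p < n ] (e p * 𝟙 (w Fin.≟ f x p))

  ∑-hits : ∀ x → ∑[ w < q ] hits x w ≡ M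
  ∑-hits x = begin
    ∑[ w < q ] ∑[ p < n ] (e p * 𝟙 (w Fin.≟ f x p)) ≡⟨ ∑-comm (λ w p → e p * 𝟙 (w Fin.≟ f x p)) ⟩
    ∑[ p < n ] ∑[ w < q ] (e p * 𝟙 (w Fin.≟ f x p)) ≡⟨ sum-cong-≗ (λ p → sym (*-distribˡ-sum (e p) λ w → 𝟙 (w Fin.≟ f x p))) ⟩
    ∑[ p < n ] (e p * ∑[ w < q ] 𝟙 (w Fin.≟ f x p)) ≡⟨ sum-cong-≗ (λ p → trans (cong (e p *_) (∑-δ₁ (f x p))) (*-identityʳ (e p))) ⟩
    M                                               ∎
    where open ≡-Reasoning

  -- Only one factor of the square is expanded: each curve p meets the column over x in a single
  -- point, and the other factor is evaluated there.
  ∑-hits² : ∀ x → ∑[ w < q ] (hits x w * hits x w) ≡ ∑[ p < n ] (e p * hits x (f x p))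
  ∑-hits² x = begin
    ∑[ w < q ] (hits x w * hits x w)
      ≡⟨ sum-cong-≗ (λ w → *-distribʳ-sum (hits x w) λ p → e p * δ w p) ⟩
    ∑[ w < q ] ∑[ p < n ] (e p * δ w p * hits x w)
      ≡⟨ ∑-comm (λ w p → e p * δ w p * hits x w) ⟩
    ∑[ p < n ] ∑[ w < q ] (e p * δ w p * hits x w)
      ≡⟨ sum-cong-≗ (λ p → sum-cong-≗ λ w → *-assoc (e p) (δ w p) (hits x w)) ⟩
    ∑[ p < n ] ∑[ w < q ] (e p * (δ w p * hits x w))
      ≡⟨ sum-cong-≗ (λ p → sym (*-distribˡ-sum (e p) λ w → δ w p * hits x w)) ⟩
    ∑[ p < n ] (e p * ∑[ w < q ] (δ w p * hits x w))
      ≡⟨ sum-cong-≗ (λ p → cong (e p *_) (∑-δ (hits x) (f x p))) ⟩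
    ∑[ p < n ] (e p * hits x (f x p)) ∎
    where
    open ≡-Reasoning
    δ : Fin q → Fin n → ℕ
    δ w p = 𝟙 (w Fin.≟ f x p)

  -- The number `s p p′` is positive when the curves p and p′ may coincide. Otherwise `agree` says
  -- that they meet over at most one x. The total weight of the exceptional partners of a curve is
  -- at most c.
  module _ (s : Fin n → Fin n → ℕ) (c : ℕ)
           (agree : ∀ p p′ → ∑[ x < q ] 𝟙 (f x p Fin.≟ f x p′) ≤ 1 + q * s p p′)
           (few : ∀ p → ∑[ p′ < n ] (e p′ * s p p′) ≤ c) where

    -- Exchanging the sums counts the meetings of p with every p′. The one generic meeting gives M
    -- in total, and the exceptional partners add at most q each, weighted.
    ∑-hits-along : ∀ p → ∑[ x < q ] hits x (f x p) ≤ M + q * c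
    ∑-hits-along p = begin
      ∑[ x < q ] ∑[ p′ < n ] (e p′ * 𝟙 (f x p Fin.≟ f x p′))
        ≡⟨ ∑-comm (λ x p′ → e p′ * 𝟙 (f x p Fin.≟ f x p′)) ⟩
      ∑[ p′ < n ] ∑[ x < q ] (e p′ * 𝟙 (f x p Fin.≟ f x p′))
        ≡⟨ sum-cong-≗ (λ p′ → sym (*-distribˡ-sum (e p′) λ x → 𝟙 (f x p Fin.≟ f x p′))) ⟩
      ∑[ p′ < n ] (e p′ * ∑[ x < q ] 𝟙 (f x p Fin.≟ f x p′))
        ≤⟨ ∑-mono-≤ (λ p′ → *-monoʳ-≤ (e p′) (agree p p′)) ⟩
      ∑[ p′ < n ] (e p′ * (1 + q * s p p′))
        ≡⟨ sum-cong-≗ (λ p′ → solveℕ 3 (λ e q s → e :* (con 1 :+ q :* s) := e :+ q :* (e :* s)) refl (e p′) q (s p p′)) ⟩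
      ∑[ p′ < n ] (e p′ + q * (e p′ * s p p′))
        ≡⟨ ∑-distrib-+ e (λ p′ → q * (e p′ * s p p′)) ⟩
      M + ∑[ p′ < n ] (q * (e p′ * s p p′))
        ≡⟨ cong (M +_) (sym (*-distribˡ-sum q λ p′ → e p′ * s p p′)) ⟩
      M + q * ∑[ p′ < n ] (e p′ * s p p′)
        ≤⟨ +-monoʳ-≤ M (*-monoʳ-≤ q (few p)) ⟩
      M + q * c ∎
      where open ≤-Reasoning

    secondMoment : ∑[ x < q ] ∑[ w < q ] (hits x w * hits x w) ≤ M * (M + q * c)
    secondMoment = begin
      ∑[ x < q ] ∑[ w < q ] (hits x w * hits x w)       ≡⟨ sum-cong-≗ ∑-hits² ⟩
      ∑[ x < q ] ∑[ p < n ] (e p * hits x (f x p))      ≡⟨ ∑-comm (λ x p → e p * hits x (f x p)) ⟩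
      ∑[ p < n ] ∑[ x < q ] (e p * hits x (f x p))      ≡⟨ sum-cong-≗ (λ p → sym (*-distribˡ-sum (e p) λ x → hits x (f x p))) ⟩
      ∑[ p < n ] (e p * ∑[ x < q ] hits x (f x p))      ≤⟨ ∑-mono-≤ (λ p → *-monoʳ-≤ (e p) (∑-hits-along p)) ⟩
      ∑[ p < n ] (e p * (M + q * c))                    ≡⟨ sym (*-distribʳ-sum (M + q * c) e) ⟩
      M * (M + q * c)                                   ∎
      where open ≤-Reasoning

    -- `Z` is the indicator of a set of points through which no weighted curve passes.
    module _ (Z : Fin q → Fin q → ℕ) (Z≤1 : ∀ x w → Z x w ≤ 1)
             (missed : ∀ x w → Z x w ≡ 0 ⊎ hits x w ≡ 0) where

      -- The variance inequality (q·hits − M)² ≥ M²·Z with the cross term moved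
      -- to the left, so that no subtraction occurs.
      variance : ∀ x w → 2 * (q * M) * hits x w + M * M * Z x w ≤ q * q * (hits x w * hits x w) + M * M
      variance x w with missed x w
      ... | inj₁ Z≡0 rewrite Z≡0 = begin
        2 * (q * M) * h + M * M * 0      ≡⟨ solveℕ 3 (λ q M h → con 2 :* (q :* M) :* h :+ M :* M :* con 0 := con 2 :* (q :* h :* M)) refl q M h ⟩
        2 * (q * h * M)                  ≤⟨ 2ab≤a²+b² (q * h) M ⟩
        q * h * (q * h) + M * M          ≡⟨ solveℕ 3 (λ q M h → q :* h :* (q :* h) :+ M :* M := q :* q :* (h :* h) :+ M :* M) refl q M h ⟩
        q * q * (h * h) + M * M          ∎
        where
        open ≤-Reasoning
        h : ℕ
        h = hits x w
      ... | inj₂ h≡0 rewrite h≡0 = begin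
        2 * (q * M) * 0 + M * M * Z x w  ≡⟨ cong (_+ M * M * Z x w) (*-zeroʳ (2 * (q * M))) ⟩
        M * M * Z x w                    ≤⟨ *-monoʳ-≤ (M * M) (Z≤1 x w) ⟩
        M * M * 1                        ≡⟨ *-identityʳ (M * M) ⟩
        M * M                            ≤⟨ m≤n+m (M * M) (q * q * 0) ⟩
        q * q * 0 + M * M                ∎
        where open ≤-Reasoning

      private
        ζ : ℕ
        ζ = ∑[ x < q ] ∑[ w < q ] Z x w

        linear : ∀ (a b : ℕ) (g h : Fin q → Fin q → ℕ) →
                 ∑[ x < q ] ∑[ w < q ] (a * g x w + b * h x w)
                 ≡ a * (∑[ x < q ] ∑[ w < q ] g x w) + b * (∑[ x < q ] ∑[ w < q ] h x w)
        linear a b g h = begin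
          ∑[ x < q ] ∑[ w < q ] (a * g x w + b * h x w)
            ≡⟨ sum-cong-≗ (λ x → ∑-distrib-+ (λ w → a * g x w) (λ w → b * h x w)) ⟩
          ∑[ x < q ] (∑[ w < q ] (a * g x w) + ∑[ w < q ] (b * h x w))
            ≡⟨ ∑-distrib-+ (λ x → ∑[ w < q ] (a * g x w)) (λ x → ∑[ w < q ] (b * h x w)) ⟩
          ∑[ x < q ] ∑[ w < q ] (a * g x w) + ∑[ x < q ] ∑[ w < q ] (b * h x w)
            ≡⟨ cong₂ _+_ (pull a g) (pull b h) ⟩
          a * (∑[ x < q ] ∑[ w < q ] g x w) + b * (∑[ x < q ] ∑[ w < q ] h x w) ∎
          where
          open ≡-Reasoning
          pull : ∀ (a : ℕ) (g : Fin q → Fin q → ℕ) → ∑[ x < q ] ∑[ w < q ] (a * g x w) ≡ a * (∑[ x < q ] ∑[ w < q ] g x w)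
          pull a g = trans (sum-cong-≗ λ x → sym (*-distribˡ-sum a (g x)))
                           (sym (*-distribˡ-sum a λ x → ∑[ w < q ] g x w))

      -- This is `variance` summed over all q² points. Since the hits total qM, the cross term
      -- becomes 2(qM)² and is cancelled. A factor M stays on both sides because M may still be zero
      -- here.
      missed-bound : M * M * ζ ≤ M * (q * q * q * c)
      missed-bound = +-cancelˡ-≤ (2 * (q * M) * (q * M)) _ _ (begin
        2 * (q * M) * (q * M) + M * M * ζ
          ≡⟨ cong (λ t → 2 * (q * M) * t + M * M * ζ) (sym (trans (sum-cong-≗ ∑-hits) (∑-const q M))) ⟩
        2 * (q * M) * (∑[ x < q ] ∑[ w < q ] hits x w) + M * M * ζ
          ≡⟨ sym (linear (2 * (q * M)) (M * M) hits Z) ⟩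
        ∑[ x < q ] ∑[ w < q ] (2 * (q * M) * hits x w + M * M * Z x w)
          ≤⟨ ∑-mono-≤ (λ x → ∑-mono-≤ λ w → ≤-trans (variance x w) (≤-reflexive (cong (q * q * (hits x w * hits x w) +_) (sym (*-identityʳ (M * M)))))) ⟩
        ∑[ x < q ] ∑[ w < q ] (q * q * (hits x w * hits x w) + M * M * 1)
          ≡⟨ linear (q * q) (M * M) (λ x w → hits x w * hits x w) (λ _ _ → 1) ⟩
        q * q * (∑[ x < q ] ∑[ w < q ] (hits x w * hits x w)) + M * M * (∑[ x < q ] ∑[ w < q ] 1)
          ≤⟨ +-mono-≤ (*-monoʳ-≤ (q * q) secondMoment) (≤-reflexive (cong (M * M *_) (trans (∑-const q (∑[ w < q ] 1)) (cong (q *_) (∑-const q 1))))) ⟩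
        -- The main term of the second moment and the constant M² over q² points each give (qM)²,
        -- which together match the cancelled cross term.
        q * q * (M * (M + q * c)) + M * M * (q * (q * 1))
          ≡⟨ solveℕ 3 (λ q M c → q :* q :* (M :* (M :+ q :* c)) :+ M :* M :* (q :* (q :* con 1))
               := con 2 :* (q :* M) :* (q :* M) :+ M :* (q :* q :* q :* c)) refl q M c ⟩
        2 * (q * M) * (q * M) + M * (q * q * q * c) ∎)
        where open ≤-Reasoning

-- Algebra in a field of odd order

module OddField {q : ℕ} (F : FiniteField q) (odd : ¬ (2 ∣ q)) where

  open FiniteField F renaming (_+_ to infixl 6 _⊕_; _*_ to infixl 7 _⊗_; -_ to infix 8 ⊖_; _-_ to infixl 6 _⊝_)
  open IsCommutativeRing isCommutativeRing using (isCommutativeSemiring)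
    renaming (+-assoc to ⊕-assoc; +-comm to ⊕-comm; +-identityʳ to ⊕-identityʳ; -‿inverseˡ to ⊖-inverseˡ;
              -‿inverseʳ to ⊖-inverseʳ; *-assoc to ⊗-assoc; *-comm to ⊗-comm; *-identityˡ to ⊗-identityˡ)

  private
    -- The solver sees only the semiring structure, so negatives enter its identities as atoms and
    -- every equation is stated with terms moved across.
    R : CommutativeSemiring _ _
    R = record { isCommutativeSemiring = isCommutativeSemiring }

  open SemiringSolver R using () renaming (solve to solveF; _:+_ to _⊞_; _:*_ to _⊠_; _:=_ to _≐_; con to conF)

  ⊕-cancelʳ : ∀ c {a b} → a ⊕ c ≡ b ⊕ c → a ≡ b
  ⊕-cancelʳ c {a} {b} eq = begin
    a               ≡⟨ undo a ⟨
    a ⊕ c ⊕ (⊖ c)   ≡⟨ cong (_⊕ (⊖ c)) eq ⟩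
    b ⊕ c ⊕ (⊖ c)   ≡⟨ undo b ⟩
    b               ∎
    where
    open ≡-Reasoning
    undo : ∀ a → a ⊕ c ⊕ (⊖ c) ≡ a
    undo a = trans (⊕-assoc a c (⊖ c)) (trans (cong (a ⊕_) (⊖-inverseʳ c)) (⊕-identityʳ a))

  ⊗-cancelˡ : ∀ {h a b} → h ≢ 0# → h ⊗ a ≡ h ⊗ b → a ≡ b
  ⊗-cancelˡ {h} {a} {b} h≢0 eq with k , hk≡1 ← inverse h h≢0 = begin
    a             ≡⟨ undo a ⟨
    k ⊗ (h ⊗ a)   ≡⟨ cong (k ⊗_) eq ⟩
    k ⊗ (h ⊗ b)   ≡⟨ undo b ⟩
    b             ∎
    where
    open ≡-Reasoning
    undo : ∀ a → k ⊗ (h ⊗ a) ≡ a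
    undo a = trans (sym (⊗-assoc k h a))
      (trans (cong (_⊗ a) (trans (⊗-comm k h) hk≡1)) (⊗-identityˡ a))

  ⊖-injective : ∀ {a b} → ⊖ a ≡ ⊖ b → a ≡ b
  ⊖-injective {a} {b} eq = ⊕-cancelʳ (⊖ a)
    (trans (⊖-inverseʳ a) (sym (trans (cong (b ⊕_) eq) (⊖-inverseʳ b))))

  -- If 2 = 0, then x ↦ x + 1 is an involution, without fixed points because 0 ≠ 1, and q would be
  -- even.
  2≢0 : 2# ≢ 0#
  2≢0 2≡0 = odd (fixedPointFreeInvolution⇒even (_⊕ 1#)
    (λ x → trans (⊕-assoc x 1# 1#) (trans (cong (x ⊕_) 2≡0) (⊕-identityʳ x)))
    (λ x x+1≡x → 0≢1 (sym (⊕-cancelʳ x (trans (⊕-comm 1# x)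
      (trans x+1≡x (sym (trans (⊕-comm 0# x) (⊕-identityʳ x)))))))))

  -- (a − c)(b − d) = 0, with the negative terms moved across.
  zeroProduct : ∀ a b c d → (a ⊗ b) ⊕ (c ⊗ d) ≡ (a ⊗ d) ⊕ (c ⊗ b) → a ≡ c ⊎ b ≡ d
  zeroProduct a b c d eq with a Fin.≟ c
  ... | yes a≡c = inj₁ a≡c
  -- With h = a - c, adding cb + cd to both sides of hb = hd turns it into the hypothesis.
  ... | no a≢c = inj₂ (⊗-cancelˡ h≢0 (⊕-cancelʳ ((c ⊗ b) ⊕ (c ⊗ d)) (begin
    (h ⊗ b) ⊕ ((c ⊗ b) ⊕ (c ⊗ d))   ≡⟨ solveF 4 (λ h b c d → h ⊠ b ⊞ (c ⊠ b ⊞ c ⊠ d) ≐ (h ⊞ c) ⊠ b ⊞ c ⊠ d) refl h b c d ⟩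
    ((h ⊕ c) ⊗ b) ⊕ (c ⊗ d)         ≡⟨ cong (λ t → (t ⊗ b) ⊕ (c ⊗ d)) h+c≡a ⟩
    (a ⊗ b) ⊕ (c ⊗ d)               ≡⟨ eq ⟩
    (a ⊗ d) ⊕ (c ⊗ b)               ≡⟨ cong (λ t → (t ⊗ d) ⊕ (c ⊗ b)) h+c≡a ⟨
    ((h ⊕ c) ⊗ d) ⊕ (c ⊗ b)         ≡⟨ solveF 4 (λ h b c d → (h ⊞ c) ⊠ d ⊞ c ⊠ b ≐ h ⊠ d ⊞ (c ⊠ b ⊞ c ⊠ d)) refl h b c d ⟩
    (h ⊗ d) ⊕ ((c ⊗ b) ⊕ (c ⊗ d))   ∎)))
    where
    open ≡-Reasoning
    h : Fin q
    h = a ⊕ (⊖ c)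
    h+c≡a : h ⊕ c ≡ a
    h+c≡a = trans (⊕-assoc a (⊖ c) c) (trans (cong (a ⊕_) (⊖-inverseˡ c)) (⊕-identityʳ a))
    h≢0 : h ≢ 0#
    h≢0 h≡0 = a≢c (trans (sym h+c≡a) (trans (cong (_⊕ c) h≡0) (trans (⊕-comm 0# c) (⊕-identityʳ c))))

  halve : ∀ {a b} → a ⊕ a ≡ b ⊕ b → a ≡ b
  halve {a} {b} eq = ⊗-cancelˡ 2≢0 (trans (double a) (trans eq (sym (double b))))
    where
    double : ∀ a → 2# ⊗ a ≡ a ⊕ a
    double a = solveF 1 (λ a → (conF 1 ⊞ conF 1) ⊠ a ≐ a ⊞ a) refl a

  -- From 2yz = (y + z)² - (y² + z²) the products agree as well. So y is a root of the quadratic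
  -- with roots y′ and z′, that is, (y - y′)(y - z′) = 0, and the sum then determines z.
  samePair : ∀ {y z y′ z′} → y ⊕ z ≡ y′ ⊕ z′ → (y ⊗ y) ⊕ (z ⊗ z) ≡ (y′ ⊗ y′) ⊕ (z′ ⊗ z′) →
             y ≡ y′ × z ≡ z′ ⊎ y ≡ z′ × z ≡ y′
  samePair {y} {z} {y′} {z′} sums squares = Sum.map first second (zeroProduct y y y′ z′ vanishes)
    where
    open ≡-Reasoning
    products : y ⊗ z ≡ y′ ⊗ z′
    products = halve (⊕-cancelʳ ((y ⊗ y) ⊕ (z ⊗ z)) (begin
      ((y ⊗ z) ⊕ (y ⊗ z)) ⊕ ((y ⊗ y) ⊕ (z ⊗ z))
        ≡⟨ solveF 2 (λ y z → (y ⊠ z ⊞ y ⊠ z) ⊞ (y ⊠ y ⊞ z ⊠ z) ≐ (y ⊞ z) ⊠ (y ⊞ z)) refl y z ⟩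
      (y ⊕ z) ⊗ (y ⊕ z)
        ≡⟨ cong (λ t → t ⊗ t) sums ⟩
      (y′ ⊕ z′) ⊗ (y′ ⊕ z′)
        ≡⟨ solveF 2 (λ y z → (y ⊞ z) ⊠ (y ⊞ z) ≐ (y ⊠ z ⊞ y ⊠ z) ⊞ (y ⊠ y ⊞ z ⊠ z)) refl y′ z′ ⟩
      ((y′ ⊗ z′) ⊕ (y′ ⊗ z′)) ⊕ ((y′ ⊗ y′) ⊕ (z′ ⊗ z′))
        ≡⟨ cong (((y′ ⊗ z′) ⊕ (y′ ⊗ z′)) ⊕_) (sym squares) ⟩
      ((y′ ⊗ z′) ⊕ (y′ ⊗ z′)) ⊕ ((y ⊗ y) ⊕ (z ⊗ z)) ∎))
    vanishes : (y ⊗ y) ⊕ (y′ ⊗ z′) ≡ (y ⊗ z′) ⊕ (y′ ⊗ y)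
    vanishes = begin
      (y ⊗ y) ⊕ (y′ ⊗ z′)   ≡⟨ cong ((y ⊗ y) ⊕_) (sym products) ⟩
      (y ⊗ y) ⊕ (y ⊗ z)     ≡⟨ solveF 2 (λ y z → y ⊠ y ⊞ y ⊠ z ≐ y ⊠ (y ⊞ z)) refl y z ⟩
      y ⊗ (y ⊕ z)           ≡⟨ cong (y ⊗_) sums ⟩
      y ⊗ (y′ ⊕ z′)         ≡⟨ solveF 3 (λ y y′ z′ → y ⊠ (y′ ⊞ z′) ≐ y ⊠ z′ ⊞ y′ ⊠ y) refl y y′ z′ ⟩
      (y ⊗ z′) ⊕ (y′ ⊗ y)   ∎
    first : y ≡ y′ → y ≡ y′ × z ≡ z′
    first refl = refl , ⊕-cancelʳ y (trans (⊕-comm z y) (trans sums (⊕-comm y z′)))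
    second : y ≡ z′ → y ≡ z′ × z ≡ y′
    second refl = refl , ⊕-cancelʳ y (trans (⊕-comm z y) sums)

  box : Fin q → Fin q → Fin q → Fin q
  box x y z = sq (x ⊝ y) ⊕ sq (x ⊝ z)

  -- box x y z = 2x² − 2x(y + z) + (y² + z²), so two pairs agreeing at two
  -- values of x have the same sum and the same sum of squares.
  box-agree : ∀ {x₁ x₂ y z y′ z′} → x₁ ≢ x₂ →
              box x₁ y z ≡ box x₁ y′ z′ → box x₂ y z ≡ box x₂ y′ z′ →
              y ≡ y′ × z ≡ z′ ⊎ y ≡ z′ × z ≡ y′
  box-agree {x₁} {x₂} {y} {z} {y′} {z′} x₁≢x₂ eq₁ eq₂ = conclude (zeroProduct x₁ S x₂ S′ crossed)
    where
    open ≡-Reasoning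
    S S′ N N′ : Fin q
    S  = (⊖ y) ⊕ (⊖ z)
    S′ = (⊖ y′) ⊕ (⊖ z′)
    N  = sq (⊖ y) ⊕ sq (⊖ z)
    N′ = sq (⊖ y′) ⊕ sq (⊖ z′)
    -- Adding the first agreement to the reversed second one puts the same x² terms and N + N′ on
    -- both sides. What remains is 2(x₁ - x₂)(S - S′) = 0, in the form `zeroProduct` takes.
    crossed : (x₁ ⊗ S) ⊕ (x₂ ⊗ S′) ≡ (x₁ ⊗ S′) ⊕ (x₂ ⊗ S)
    crossed = halve (⊕-cancelʳ (2# ⊗ (sq x₁ ⊕ sq x₂) ⊕ (N ⊕ N′)) (begin
      _ ≡⟨ expand x₁ x₂ (⊖ y) (⊖ z) (⊖ y′) (⊖ z′) ⟩
      box x₁ y z ⊕ box x₂ y′ z′ ≡⟨ cong₂ _⊕_ eq₁ (sym eq₂) ⟩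
      box x₁ y′ z′ ⊕ box x₂ y z ≡⟨ expand x₁ x₂ (⊖ y′) (⊖ z′) (⊖ y) (⊖ z) ⟨
      _ ≡⟨ cong (λ t → (x₁ ⊗ S′ ⊕ x₂ ⊗ S) ⊕ (x₁ ⊗ S′ ⊕ x₂ ⊗ S) ⊕ (2# ⊗ (sq x₁ ⊕ sq x₂) ⊕ t)) (⊕-comm N′ N) ⟩
      _ ∎))
      where
      expand : ∀ x₁ x₂ y z y′ z′ →
        (((x₁ ⊗ (y ⊕ z)) ⊕ (x₂ ⊗ (y′ ⊕ z′))) ⊕ ((x₁ ⊗ (y ⊕ z)) ⊕ (x₂ ⊗ (y′ ⊕ z′))))
          ⊕ (2# ⊗ (sq x₁ ⊕ sq x₂) ⊕ ((sq y ⊕ sq z) ⊕ (sq y′ ⊕ sq z′)))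
        ≡ (sq (x₁ ⊕ y) ⊕ sq (x₁ ⊕ z)) ⊕ (sq (x₂ ⊕ y′) ⊕ sq (x₂ ⊕ z′))
      expand = solveF 6 (λ x₁ x₂ y z y′ z′ →
        ((x₁ ⊠ (y ⊞ z)) ⊞ (x₂ ⊠ (y′ ⊞ z′))) ⊞ ((x₁ ⊠ (y ⊞ z)) ⊞ (x₂ ⊠ (y′ ⊞ z′)))
          ⊞ ((conF 1 ⊞ conF 1) ⊠ (x₁ ⊠ x₁ ⊞ x₂ ⊠ x₂) ⊞ ((y ⊠ y ⊞ z ⊠ z) ⊞ (y′ ⊠ y′ ⊞ z′ ⊠ z′)))
        ≐ ((x₁ ⊞ y) ⊠ (x₁ ⊞ y) ⊞ (x₁ ⊞ z) ⊠ (x₁ ⊞ z))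
          ⊞ ((x₂ ⊞ y′) ⊠ (x₂ ⊞ y′) ⊞ (x₂ ⊞ z′) ⊠ (x₂ ⊞ z′))) refl
    squares : S ≡ S′ → N ≡ N′
    squares S≡S′ = ⊕-cancelʳ (2# ⊗ (sq x₁ ⊕ x₁ ⊗ S)) (begin
      N ⊕ 2# ⊗ (sq x₁ ⊕ x₁ ⊗ S)     ≡⟨ expand x₁ (⊖ y) (⊖ z) ⟩
      box x₁ y z                    ≡⟨ eq₁ ⟩
      box x₁ y′ z′                  ≡⟨ expand x₁ (⊖ y′) (⊖ z′) ⟨
      N′ ⊕ 2# ⊗ (sq x₁ ⊕ x₁ ⊗ S′)   ≡⟨ cong (λ t → N′ ⊕ 2# ⊗ (sq x₁ ⊕ x₁ ⊗ t)) S≡S′ ⟨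
      N′ ⊕ 2# ⊗ (sq x₁ ⊕ x₁ ⊗ S)    ∎)
      where
      expand : ∀ x y z → (sq y ⊕ sq z) ⊕ 2# ⊗ (sq x ⊕ x ⊗ (y ⊕ z)) ≡ sq (x ⊕ y) ⊕ sq (x ⊕ z)
      expand = solveF 3 (λ x y z → (y ⊠ y ⊞ z ⊠ z) ⊞ (conF 1 ⊞ conF 1) ⊠ (x ⊠ x ⊞ x ⊠ (y ⊞ z))
        ≐ (x ⊞ y) ⊠ (x ⊞ y) ⊞ (x ⊞ z) ⊠ (x ⊞ z)) refl
    conclude : x₁ ≡ x₂ ⊎ S ≡ S′ → y ≡ y′ × z ≡ z′ ⊎ y ≡ z′ × z ≡ y′
    conclude (inj₁ x₁≡x₂) = ⊥-elim (x₁≢x₂ x₁≡x₂)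
    -- S and N are built from -y and -z, so the pairs are first identified up to sign and the signs
    -- are then removed.
    conclude (inj₂ S≡S′)  = Sum.map negate negate (samePair S≡S′ (squares S≡S′))
      where
      negate : ∀ {a b c d} → ⊖ a ≡ ⊖ b × ⊖ c ≡ ⊖ d → a ≡ b × c ≡ d
      negate = Product.map ⊖-injective ⊖-injective

  box∈Box : ∀ {E x y z w} → x ∈ E → y ∈ E → z ∈ E → y ≢ z → w ≡ box x y z → w ∈ Box E
  box∈Box {E} {x} {y} {z} {w} x∈E y∈E z∈E y≢z w≡ = lookup⇒[]= w (Box E)
    (trans (lookup∘tabulate _ w) (⌊⌋-true _ inBox))
    where
    inBox : InBox E w
    inBox = x , y , z , x∈E , y∈E , z∈E , y≢z , w≡

-- Missed values of the box form

-- The square of |E| counts all ordered pairs from E. The diagonal ones number |E|, since an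
-- indicator equals its own square.
∑-offDiagonal : ∀ {n} (E : Subset n) →
  ∑[ y < n ] ∑[ z < n ] (𝟙 (y ∈? E) * 𝟙 (z ∈? E) * 𝟙 (¬? (y Fin.≟ z))) + ∣ E ∣ ≡ ∣ E ∣ * ∣ E ∣
∑-offDiagonal {n} E = begin
  ∑[ y < n ] ∑[ z < n ] off y z + ∣ E ∣
    ≡⟨ cong (∑[ y < n ] ∑[ z < n ] off y z +_) (trans (∣p∣≡∑𝟙 E) (sum-cong-≗ diagonal)) ⟩
  ∑[ y < n ] ∑[ z < n ] off y z + ∑[ y < n ] ∑[ z < n ] on y z
    ≡⟨ ∑-distrib-+ (λ y → ∑[ z < n ] off y z) (λ y → ∑[ z < n ] on y z) ⟨
  ∑[ y < n ] (∑[ z < n ] off y z + ∑[ z < n ] on y z)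
    ≡⟨ sum-cong-≗ (λ y → trans (sym (∑-distrib-+ (off y) (on y))) (sum-cong-≗ (merge y))) ⟩
  ∑[ y < n ] ∑[ z < n ] (χ y * χ z)
    ≡⟨ ∑-product χ χ ⟩
  sum χ * sum χ
    ≡⟨ cong₂ _*_ (∣p∣≡∑𝟙 E) (∣p∣≡∑𝟙 E) ⟨
  ∣ E ∣ * ∣ E ∣ ∎
  where
  open ≡-Reasoning
  χ : Fin n → ℕ
  χ y = 𝟙 (y ∈? E)
  off on : Fin n → Fin n → ℕ
  off y z = χ y * χ z * 𝟙 (¬? (y Fin.≟ z))
  on y z  = 𝟙 (z Fin.≟ y) * (χ y * χ z)
  𝟙-idem : ∀ {A : Set} (d : Dec A) → 𝟙 d ≡ 𝟙 d * 𝟙 d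
  𝟙-idem (yes _) = refl
  𝟙-idem (no _)  = refl
  diagonal : ∀ y → χ y ≡ ∑[ z < n ] on y z
  diagonal y = trans (𝟙-idem (y ∈? E)) (sym (∑-δ (λ z → χ y * χ z) y))
  merge : ∀ y z → off y z + on y z ≡ χ y * χ z
  merge y z with y Fin.≟ z
  ... | yes y≡z rewrite 𝟙-true (z Fin.≟ y) (sym y≡z) =
    trans (cong (_+ (χ y * χ z + 0)) (*-zeroʳ (χ y * χ z))) (+-identityʳ (χ y * χ z))
  ... | no y≢z rewrite 𝟙-false (z Fin.≟ y) (y≢z ∘ sym) =
    trans (+-identityʳ _) (*-identityʳ (χ y * χ z))

module Count {q : ℕ} (F : FiniteField q) (odd : ¬ (2 ∣ q)) (E : Subset q) where

  open FiniteField F using (Box)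
  open OddField F odd

  private
    weight : Fin q → Fin q → ℕ
    weight y z = 𝟙 (y ∈? E) * 𝟙 (z ∈? E) * 𝟙 (¬? (y Fin.≟ z))

    -- This counts in how many of the two orders (y′ , z′) matches (y , z). It is 2 when all four
    -- entries are equal, which makes its total over (y′ , z′) exactly 2 in every case.
    same : Fin q → Fin q → Fin q → Fin q → ℕ
    same y z y′ z′ = 𝟙 (y′ Fin.≟ y) * 𝟙 (z′ Fin.≟ z) + 𝟙 (z′ Fin.≟ y) * 𝟙 (y′ Fin.≟ z)

    e : Fin (q * q) → ℕ
    e p = uncurry weight (remQuot q p)

    f : Fin q → Fin (q * q) → Fin q
    f x p = uncurry (box x) (remQuot q p)

    s : Fin (q * q) → Fin (q * q) → ℕ
    s p p′ = uncurry (uncurry same (remQuot q p)) (remQuot q p′)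

    open Incidence e f

    -- For equal unordered pairs the trivial bound q suffices. For different ones `box-agree`
    -- excludes two distinct values of x.
    agree₂ : ∀ y z y′ z′ → ∑[ x < q ] 𝟙 (box x y z Fin.≟ box x y′ z′) ≤ 1 + q * same y z y′ z′
    agree₂ y z y′ z′ = byCases (1 ≤? same y z y′ z′)
      where
      byCases : Dec (1 ≤ same y z y′ z′) → ∑[ x < q ] 𝟙 (box x y z Fin.≟ box x y′ z′) ≤ 1 + q * same y z y′ z′
      byCases (yes 1≤s) = begin
        ∑[ x < q ] 𝟙 (box x y z Fin.≟ box x y′ z′) ≤⟨ ∑-𝟙-≤n (λ x → box x y z Fin.≟ box x y′ z′) ⟩
        q                                          ≡⟨ *-identityʳ q ⟨
        q * 1                                      ≤⟨ *-monoʳ-≤ q 1≤s ⟩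
        q * same y z y′ z′                         ≤⟨ n≤1+n _ ⟩
        1 + q * same y z y′ z′                     ∎
        where open ≤-Reasoning
      byCases (no 1≰s) = ≤-trans (∑-𝟙-atMostOne (λ x → box x y z Fin.≟ box x y′ z′) unique) (m≤m+n 1 _)
        where
        positive : y ≡ y′ × z ≡ z′ ⊎ y ≡ z′ × z ≡ y′ → 1 ≤ same y z y′ z′
        positive (inj₁ (refl , refl)) rewrite 𝟙-true (y Fin.≟ y) refl | 𝟙-true (z Fin.≟ z) refl = s≤s z≤n
        positive (inj₂ (refl , refl)) rewrite 𝟙-true (y Fin.≟ y) refl | 𝟙-true (z Fin.≟ z) refl = m≤n+m 1 _
        unique : ∀ {x₁ x₂} → box x₁ y z ≡ box x₁ y′ z′ → box x₂ y z ≡ box x₂ y′ z′ → x₁ ≡ x₂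
        unique {x₁} {x₂} eq₁ eq₂ with x₁ Fin.≟ x₂
        ... | yes x₁≡x₂ = x₁≡x₂
        ... | no x₁≢x₂  = ⊥-elim (1≰s (positive (box-agree x₁≢x₂ eq₁ eq₂)))

    agree : ∀ p p′ → ∑[ x < q ] 𝟙 (f x p Fin.≟ f x p′) ≤ 1 + q * s p p′
    agree p p′ = uncurry (uncurry agree₂ (remQuot {q} q p)) (remQuot {q} q p′)

    weight≤1 : ∀ y z → weight y z ≤ 1
    weight≤1 y z = *-mono-≤ (*-mono-≤ (𝟙≤1 (y ∈? E)) (𝟙≤1 (z ∈? E))) (𝟙≤1 (¬? (y Fin.≟ z)))

    ∑-same : ∀ y z → ∑[ y′ < q ] ∑[ z′ < q ] same y z y′ z′ ≡ 2
    ∑-same y z = begin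
      ∑[ y′ < q ] ∑[ z′ < q ] same y z y′ z′
        ≡⟨ sum-cong-≗ (λ y′ → ∑-distrib-+ (λ z′ → 𝟙 (y′ Fin.≟ y) * 𝟙 (z′ Fin.≟ z)) (λ z′ → 𝟙 (z′ Fin.≟ y) * 𝟙 (y′ Fin.≟ z))) ⟩
      ∑[ y′ < q ] (∑[ z′ < q ] (𝟙 (y′ Fin.≟ y) * 𝟙 (z′ Fin.≟ z)) + ∑[ z′ < q ] (𝟙 (z′ Fin.≟ y) * 𝟙 (y′ Fin.≟ z)))
        ≡⟨ ∑-distrib-+ (λ y′ → ∑[ z′ < q ] (𝟙 (y′ Fin.≟ y) * 𝟙 (z′ Fin.≟ z))) (λ y′ → ∑[ z′ < q ] (𝟙 (z′ Fin.≟ y) * 𝟙 (y′ Fin.≟ z))) ⟩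
      ∑[ y′ < q ] ∑[ z′ < q ] (𝟙 (y′ Fin.≟ y) * 𝟙 (z′ Fin.≟ z)) + ∑[ y′ < q ] ∑[ z′ < q ] (𝟙 (z′ Fin.≟ y) * 𝟙 (y′ Fin.≟ z))
        ≡⟨ cong₂ _+_ (one y z) (trans (∑-comm (λ y′ z′ → 𝟙 (z′ Fin.≟ y) * 𝟙 (y′ Fin.≟ z))) (one y z)) ⟩
      2 ∎
      where
      open ≡-Reasoning
      one : ∀ y z → ∑[ y′ < q ] ∑[ z′ < q ] (𝟙 (y′ Fin.≟ y) * 𝟙 (z′ Fin.≟ z)) ≡ 1
      one y z = trans (∑-product (λ y′ → 𝟙 (y′ Fin.≟ y)) (λ z′ → 𝟙 (z′ Fin.≟ z))) (cong₂ _*_ (∑-δ₁ y) (∑-δ₁ z))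

    -- Weights are at most 1, and an unordered pair has at most two orderings. This is the source of
    -- the constant c = 2.
    few : ∀ p → ∑[ p′ < q * q ] (e p′ * s p p′) ≤ 2
    few p = begin
      ∑[ p′ < q * q ] (e p′ * s p p′)
        ≤⟨ ∑-mono-≤ (λ p′ → ≤-trans (*-monoˡ-≤ (s p p′) (uncurry weight≤1 (remQuot q p′))) (≤-reflexive (*-identityˡ (s p p′)))) ⟩
      ∑[ p′ < q * q ] s p p′
        ≡⟨ ∑-remQuot {q} {q} (uncurry same (remQuot q p)) ⟩
      ∑[ y′ < q ] ∑[ z′ < q ] uncurry same (remQuot q p) y′ z′
        ≡⟨ uncurry ∑-same (remQuot q p) ⟩
      2 ∎
      where open ≤-Reasoning

    Z : Fin q → Fin q → ℕ
    Z x w = 𝟙 (x ∈? E) * 𝟙 (w ∈? ∁ (Box E))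

    -- A pair of distinct elements of E whose line passes through (x , w) with x in E would witness
    -- that w lies in `Box E`.
    missed : ∀ x w → Z x w ≡ 0 ⊎ hits x w ≡ 0
    missed x w with x ∈? E | w ∈? ∁ (Box E)
    ... | no _    | _      = inj₁ refl
    ... | yes _   | no _   = inj₁ refl
    ... | yes x∈E | yes w∉ = inj₂ (∑-zero λ p → uncurry noHit (remQuot q p))
      where
      noHit : ∀ y z → weight y z * 𝟙 (w Fin.≟ box x y z) ≡ 0
      noHit y z with y ∈? E | z ∈? E | y Fin.≟ z | w Fin.≟ box x y z
      ... | no _    | _       | _      | _      = refl
      ... | yes _   | no _    | _      | _      = refl
      ... | yes _   | yes _   | yes _  | _      = refl
      ... | yes _   | yes _   | no _   | no _   = refl
      ... | yes y∈E | yes z∈E | no y≢z | yes w≡ =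
        ⊥-elim (x∈∁p⇒x∉p w∉ (box∈Box x∈E y∈E z∈E y≢z w≡))

    ∑Z : ∑[ x < q ] ∑[ w < q ] Z x w ≡ ∣ E ∣ * ∣ ∁ (Box E) ∣
    ∑Z = trans (∑-product (λ x → 𝟙 (x ∈? E)) (λ w → 𝟙 (w ∈? ∁ (Box E))))
               (sym (cong₂ _*_ (∣p∣≡∑𝟙 E) (∣p∣≡∑𝟙 (∁ (Box E)))))

  pairs : ℕ
  pairs = M

  pairs+∣E∣ : pairs + ∣ E ∣ ≡ ∣ E ∣ * ∣ E ∣
  pairs+∣E∣ = trans (cong (_+ ∣ E ∣) (∑-remQuot {q} {q} weight)) (∑-offDiagonal E)

  missed-values : pairs * pairs * (∣ E ∣ * ∣ ∁ (Box E) ∣) ≤ pairs * (q * q * q * 2)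
  missed-values = subst (λ t → M * M * t ≤ M * (q * q * q * 2)) ∑Z
    (missed-bound s 2 agree few Z (λ x w → *-mono-≤ (𝟙≤1 (x ∈? E)) (𝟙≤1 (w ∈? ∁ (Box E)))) missed)

-- The final numerical estimate

majority : ∀ q a b k m → 0 < q → b + k ≡ q → m + a ≡ a * a →
           m * m * (a * k) ≤ m * (q * q * q * 2) → (2 ^ 3) * (q ^ 2) ≤ a ^ 3 → q ≤ 2 * b
majority q a b k m 0<q b+k≡q m+a≡a² bound large with q ≤? 2 * b
... | yes q≤2b = q≤2b
-- Here a = |E|, b = |□(E)|, k counts the missed values and m the ordered pairs. If q > 2b then q <
-- 2k, and the chain squeezes 8q³ strictly below itself.
... | no q≰2b = ⊥-elim (<-irrefl refl (begin-strict
  8 * (q * q) * q         <⟨ *-monoʳ-< (8 * (q * q)) {{m*n≢0 8 (q * q) {{nonZero}} {{m*n≢0 q q}}}} q<2k ⟩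
  8 * (q * q) * (2 * k)   ≤⟨ *-monoˡ-≤ (2 * k) large′ ⟩
  a * (a * a) * (2 * k)   ≤⟨ *-monoˡ-≤ (2 * k) (*-monoʳ-≤ a a²≤2m) ⟩
  a * (2 * m) * (2 * k)   ≡⟨ solveℕ 3 (λ a m k → a :* (con 2 :* m) :* (con 2 :* k) := con 4 :* (m :* (a :* k))) refl a m k ⟩
  -- The spare factor m of `bound` can be cancelled, because m ≥ a ≥ 2.
  4 * (m * (a * k))       ≤⟨ *-monoʳ-≤ 4 (*-cancelˡ-≤ m (≤-trans (≤-reflexive (sym (*-assoc m m (a * k)))) bound)) ⟩
  4 * (q * q * q * 2)     ≡⟨ solveℕ 1 (λ q → con 4 :* (q :* q :* q :* con 2) := con 8 :* (q :* q) :* q) refl q ⟩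
  8 * (q * q) * q         ∎))
  where
  open ≤-Reasoning
  instance
    q≢0 = >-nonZero 0<q
  large′ : 8 * (q * q) ≤ a * (a * a)
  large′ = subst₂ _≤_ (cong (λ t → 8 * (q * t)) (*-identityʳ q)) (cong (λ t → a * (a * t)) (*-identityʳ a)) large
  -- If a ≤ 1 then a³ ≤ 1, against a³ ≥ 8q² ≥ 8. With a ≥ 2 the diagonal takes at most half of the
  -- a² pairs, whence a² ≤ 2m.
  2≤a : 2 ≤ a
  2≤a = ≮⇒≥ λ a<2 → <⇒≱ {1} {8} (s≤s (s≤s z≤n)) (begin
    8              ≤⟨ *-monoʳ-≤ 8 (*-mono-≤ 0<q 0<q) ⟩
    8 * (q * q)    ≤⟨ large′ ⟩
    a * (a * a)    ≤⟨ *-mono-≤ (≤-pred a<2) (*-mono-≤ (≤-pred a<2) (≤-pred a<2)) ⟩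
    1              ∎)
  a≤m : a ≤ m
  a≤m = +-cancelʳ-≤ a a m (begin
    a + a   ≡⟨ cong (a +_) (+-identityʳ a) ⟨
    2 * a   ≤⟨ *-monoˡ-≤ a 2≤a ⟩
    a * a   ≡⟨ m+a≡a² ⟨
    m + a   ∎)
  instance
    m≢0 = >-nonZero (≤-trans (s≤s z≤n) (≤-trans 2≤a a≤m))
  a²≤2m : a * a ≤ 2 * m
  a²≤2m = begin
    a * a   ≡⟨ m+a≡a² ⟨
    m + a   ≤⟨ +-monoʳ-≤ m a≤m ⟩
    m + m   ≡⟨ cong (m +_) (+-identityʳ m) ⟨
    2 * m   ∎
  q<2k : q < 2 * k
  q<2k = +-cancelˡ-< (2 * b) q (2 * k) (begin-strict
    2 * b + q       <⟨ +-monoˡ-< q (≰⇒> q≰2b) ⟩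
    q + q           ≡⟨ cong (q +_) (+-identityʳ q) ⟨
    2 * q           ≡⟨ cong (2 *_) b+k≡q ⟨
    2 * (b + k)     ≡⟨ *-distribˡ-+ 2 b k ⟩
    2 * b + 2 * k   ∎)

theorem1p12 : Σ ℕ λ C → (0 < C) × ((q : ℕ) → (F : FiniteField q) → ¬ (2 ∣ q) → FiniteField.TwoIsSquare F → (E : Subset q) → (C ^ 3) * (q ^ 2) ≤ ∣ E ∣ ^ 3 → q ≤ 2 * ∣ FiniteField.Box F E ∣)
-- With C = 2 the cubed size condition reads |E|³ ≥ 8q², and this 8 is the constant that `majority`
-- balances.
theorem1p12 = 2 , s≤s z≤n , λ q F odd _ E large →
  let open Count F odd E
      B = FiniteField.Box F E
  in majority q (∣ E ∣) (∣ B ∣) (∣ ∁ B ∣) pairs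
       -- The order q is positive because the carrier contains zero.
       (≤-trans (s≤s z≤n) (Finₚ.toℕ<n (FiniteField.0# F)))
       (trans (cong (∣ B ∣ +_) (∣∁p∣≡n∸∣p∣ B)) (m+[n∸m]≡n (∣p∣≤n B)))
       pairs+∣E∣ missed-values large
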